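{- Let $\rho$ and $\tau$ be simple types with $\rho\trianglelefteq\tau$. Then $head(\rho)=head(\tau)$, and each argument of $\rho$ is a retract of a delayed argument of $\tau$; that is, if $\rho=\rho_1\to\cdots\to\rho_\ell\to a$ with $a$ an atom, then for every $i\le \ell$ there is a delayed argument $\tau'$ of $\tau$ such that $\rho_i\trianglelefteq\tau'$.
   Context: Simple types are built from type variables (atoms) $a,b,c,\dots$ (many distinct atoms) with $\to$. If $\tau=\tau_1\to\cdots\to\tau_k\to a$ with $a$ an atom, then $head(\tau)=a$ and $\tau_1,\dots,\tau_k$ are the arguments of $\tau$. Terms are simply typed $\lambda$-terms in Church style. Retraction: $\rho\trianglelefteq\tau$ ("$\rho$ is a retract of $\tau$") means that there are a type environment $E$ and terms $C$ (the coder), $D$ (the decoder) with $E,(x:\rho)\vdash C:\tau$, $E\vdash D:\tau\to\rho$, $x\notin FV(D)$, and $DC=_{\beta\eta}x$. The types of the free variables declared in $E$ are arbitrary, and no affinity is required. Parts: if $\tau=\tau_1\to\cdots\to\tau_n\to a$ with $a$ an atom, then each $\tau_i$ is a part of $\tau$ under the path $a$ (a one-letter word over atoms); and if $\sigma$ is a part of some $\tau_i$ under a path (word) $w$, then $\sigma$ is a part of $\tau$ under the path $wa$. A delayed argument of $\tau$ is a part of $\tau$ under a path of the form $a^k$ (the letter $a$ repeated $k$ times, $a$ an atom) with $k$ odd. -}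

module Defs where

open import Data.List using (List; []; _∷_; [_]; _∷ʳ_; replicate)
open import Data.List.Membership.Propositional using (_∈_)
open import Data.List.Relation.Unary.Any using (here; there)
open import Data.Nat using (ℕ; _+_; _*_)
open import Data.Product using (∃-syntax)
open import Relation.Binary.PropositionalEquality using (_≡_; refl)

infixr 7 _⇒_
infixl 8 _·_
infix  4 _=βη_ _⊴_

Atom : Set
Atom = ℕ

data Ty : Set where
  `_  : Atom → Ty
  _⇒_ : Ty → Ty → Ty

head : Ty → Atom
head (` a)   = a
head (σ ⇒ τ) = head τ

args : Ty → List Ty
args (` a)   = []
args (σ ⇒ τ) = σ ∷ args τ

-- De Bruijn environments: the most recently declared variable comes first, so
-- E,(x:ρ) is ρ ∷ E, and a variable of type σ is a membership proof σ ∈ E.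
Env : Set
Env = List Ty

-- Intrinsically typed terms: Term E τ consists of the Church-style terms M
-- with E ⊢ M : τ, taken up to α-conversion.
data Term (E : Env) : Ty → Set where
  var : ∀ {σ} → σ ∈ E → Term E σ
  lam : ∀ {σ τ} → Term (σ ∷ E) τ → Term E (σ ⇒ τ)
  _·_ : ∀ {σ τ} → Term E (σ ⇒ τ) → Term E σ → Term E τ

Ren : Env → Env → Set
Ren E F = ∀ {σ} → σ ∈ E → σ ∈ F

liftRen : ∀ {E F σ} → Ren E F → Ren (σ ∷ E) (σ ∷ F)
liftRen r (here p)  = here p
liftRen r (there x) = there (r x)

rename : ∀ {E F τ} → Ren E F → Term E τ → Term F τ
rename r (var x) = var (r x)
rename r (lam M) = lam (rename (liftRen r) M)
rename r (M · N) = rename r M · rename r N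

weaken : ∀ {E σ τ} → Term E τ → Term (σ ∷ E) τ
weaken = rename there

Sub : Env → Env → Set
Sub E F = ∀ {σ} → σ ∈ E → Term F σ

liftSub : ∀ {E F σ} → Sub E F → Sub (σ ∷ E) (σ ∷ F)
liftSub s (here p)  = var (here p)
liftSub s (there x) = weaken (s x)

subst : ∀ {E F τ} → Sub E F → Term E τ → Term F τ
subst s (var x) = s x
subst s (lam M) = lam (subst (liftSub s) M)
subst s (M · N) = subst s M · subst s N

single : ∀ {E σ} → Term E σ → Sub (σ ∷ E) E
single N (here refl) = N
single N (there x)   = var x

_[_]₀ : ∀ {E σ τ} → Term (σ ∷ E) τ → Term E σ → Term E τ
M [ N ]₀ = subst (single N) M

data _=βη_ {E : Env} : ∀ {τ} → Term E τ → Term E τ → Set where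
  β      : ∀ {σ τ} (M : Term (σ ∷ E) τ) (N : Term E σ) →
           lam M · N =βη M [ N ]₀
  η      : ∀ {σ τ} (M : Term E (σ ⇒ τ)) →
           lam (weaken M · var (here refl)) =βη M
  ξ      : ∀ {σ τ} {M M′ : Term (σ ∷ E) τ} →
           M =βη M′ → lam M =βη lam M′
  ·-cong : ∀ {σ τ} {M M′ : Term E (σ ⇒ τ)} {N N′ : Term E σ} →
           M =βη M′ → N =βη N′ → M · N =βη M′ · N′
  =refl  : ∀ {τ} {M : Term E τ} → M =βη M
  =sym   : ∀ {τ} {M N : Term E τ} → M =βη N → N =βη M
  =trans : ∀ {τ} {M N P : Term E τ} → M =βη N → N =βη P → M =βη P

-- The variable x : ρ is the last one declared in ρ ∷ env.  The decoder lives
-- in env, which does not declare x, so x ∉ FV(D) holds by construction and D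
-- is weakened before it is applied to the coder.
record _⊴_ (ρ τ : Ty) : Set where
  field
    env     : Env
    coder   : Term (ρ ∷ env) τ
    decoder : Term env (τ ⇒ ρ)
    retract : weaken decoder · coder =βη var (here refl)

-- Part σ w τ: σ is a part of τ under the path w.
data Part (σ : Ty) : List Atom → Ty → Set where
  arg    : ∀ {τ} → σ ∈ args τ → Part σ [ head τ ] τ
  nested : ∀ {w τ τᵢ} → τᵢ ∈ args τ → Part σ w τᵢ → Part σ (w ∷ʳ head τ) τ

DelayedArgument : Ty → Ty → Set
DelayedArgument σ τ = ∃[ a ] ∃[ m ] Part σ (replicate (1 + 2 * m) a) τ

{-# OPTIONS --safe #-}
module Submission where

-- Let x : ρ be the coder's variable and let y₁, …, yℓ be fresh.  In the
-- reduction of D C y₁ … yℓ to x y₁ … yℓ, head variables alternate between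
-- coder and decoder subterms, and since every subterm in head position has
-- type of head a = head ρ, the variables bound by the coder along the way have
-- types that are parts of τ under a path aᵏ with k odd.  When x finally comes
-- into head position, the i-th argument Pᵢ found in the coder contains only x,
-- variables of E and such bound variables u⃗, and it becomes yᵢ after decoder
-- terms N⃗ are substituted for u⃗.  Giving distinct names to yᵢ in the different
-- Nⱼ, the value is a variable coming from one particular Nⱼ; that Nⱼ is a coder
-- of ρᵢ into the type of uⱼ, and Pᵢ yields the decoder.
--
-- The play is followed by a logical predicate on the terms of one fixed
-- context, which needs existence and uniqueness of long normal
-- forms; these come from a Kripke logical relation over weak-head reduction.

open import Defs
open import Data.Bool using (Bool; true; false)
open import Data.Empty using (⊥-elim)
open import Data.List using (List; []; _∷_; _++_; replicate)
open import Data.List.Membership.Propositional using (_∈_)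
open import Data.List.Membership.Propositional.Properties using (∈-++⁺ˡ; ∈-++⁺ʳ)
open import Data.List.Relation.Unary.Any using (here; there)
open import Data.Nat using (suc; _+_; _*_; _≟_)
open import Data.Nat.Properties using (*-suc)
open import Data.Product using (_×_; _,_; proj₁; proj₂; ∃-syntax)
open import Data.Sum using (_⊎_; inj₁; inj₂)
open import Data.Unit using (⊤; tt)
open import Function using (_∘_; id)
open import Relation.Nullary using (yes; no)
open import Relation.Binary.PropositionalEquality
  using (_≡_; _≢_; refl; sym; trans; cong; cong₂; module ≡-Reasoning)
  renaming (subst to transport)

private variable
  E F G H Δ     : Env
  σ τ θ κ ρ     : Ty
  a b           : Atom

-- Renaming and substitution

rename-ext : {r s : Ren E F} → (∀ {σ} (x : σ ∈ E) → r x ≡ s x) →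
             (M : Term E τ) → rename r M ≡ rename s M
rename-ext e (var x) = cong var (e x)
rename-ext e (lam M) = cong lam (rename-ext (λ { (here p) → refl ; (there x) → cong there (e x) }) M)
rename-ext e (M · N) = cong₂ _·_ (rename-ext e M) (rename-ext e N)

subst-ext : {r s : Sub E F} → (∀ {σ} (x : σ ∈ E) → r x ≡ s x) →
            (M : Term E τ) → subst r M ≡ subst s M
subst-ext e (var x) = e x
subst-ext e (lam M) = cong lam (subst-ext (λ { (here p) → refl ; (there x) → cong weaken (e x) }) M)
subst-ext e (M · N) = cong₂ _·_ (subst-ext e M) (subst-ext e N)

rename-rename : (s : Ren F G) (r : Ren E F) (M : Term E τ) →
                rename s (rename r M) ≡ rename (s ∘ r) M
rename-rename s r (var x) = refl
rename-rename s r (lam M) = cong lam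
  (trans (rename-rename (liftRen s) (liftRen r) M)
         (rename-ext (λ { (here p) → refl ; (there x) → refl }) M))
rename-rename s r (M · N) = cong₂ _·_ (rename-rename s r M) (rename-rename s r N)

rename-weaken : (r : Ren E F) (M : Term E τ) →
                rename (liftRen {σ = σ} r) (weaken M) ≡ weaken (rename r M)
rename-weaken r M = trans (rename-rename _ _ M) (sym (rename-rename _ _ M))

subst-rename : (s : Sub F G) (r : Ren E F) (M : Term E τ) →
               subst s (rename r M) ≡ subst (s ∘ r) M
subst-rename s r (var x) = refl
subst-rename s r (lam M) = cong lam
  (trans (subst-rename (liftSub s) (liftRen r) M)
         (subst-ext (λ { (here p) → refl ; (there x) → refl }) M))
subst-rename s r (M · N) = cong₂ _·_ (subst-rename s r M) (subst-rename s r N)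

rename-subst : (r : Ren F G) (s : Sub E F) (M : Term E τ) →
               rename r (subst s M) ≡ subst (rename r ∘ s) M
rename-subst r s (var x) = refl
rename-subst r s (lam M) = cong lam
  (trans (rename-subst (liftRen r) (liftSub s) M)
         (subst-ext (λ { (here p) → refl ; (there x) → rename-weaken r (s x) }) M))
rename-subst r s (M · N) = cong₂ _·_ (rename-subst r s M) (rename-subst r s N)

subst-subst : (t : Sub F G) (s : Sub E F) (M : Term E τ) →
              subst t (subst s M) ≡ subst (subst t ∘ s) M
subst-subst t s (var x) = refl
subst-subst t s (lam M) = cong lam
  (trans (subst-subst (liftSub t) (liftSub s) M)
         (subst-ext (λ { (here p)  → refl
                       ; (there x) → trans (subst-rename (liftSub t) there (s x))
                                           (sym (rename-subst there t (s x))) }) M))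
subst-subst t s (M · N) = cong₂ _·_ (subst-subst t s M) (subst-subst t s N)

subst-var : (M : Term E τ) → subst var M ≡ M
subst-var (var x) = refl
subst-var (lam M) = cong lam
  (trans (subst-ext (λ { (here p) → refl ; (there x) → refl }) M) (subst-var M))
subst-var (M · N) = cong₂ _·_ (subst-var M) (subst-var N)

subst-var∘ : (r : Ren E F) (M : Term E τ) → subst (var ∘ r) M ≡ rename r M
subst-var∘ r M = trans (sym (subst-rename var r M)) (subst-var (rename r M))

infixr 5 _◂_
_◂_ : Term F σ → Sub E F → Sub (σ ∷ E) F
(N ◂ s) (here refl) = N
(N ◂ s) (there x)   = s x

weaken-[]₀ : (M : Term E τ) (N : Term E σ) → weaken M [ N ]₀ ≡ M
weaken-[]₀ M N = trans (subst-rename (single N) there M) (subst-var M)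

subst-lift-[]₀ : (s : Sub E F) (M : Term (σ ∷ E) τ) (N : Term F σ) →
                 subst (liftSub s) M [ N ]₀ ≡ subst (N ◂ s) M
subst-lift-[]₀ s M N = trans (subst-subst (single N) (liftSub s) M)
  (subst-ext (λ { (here refl) → refl ; (there x) → weaken-[]₀ (s x) N }) M)

subst-[]₀ : (s : Sub E F) (M : Term (σ ∷ E) τ) (N : Term E σ) →
            subst s (M [ N ]₀) ≡ subst (subst s N ◂ s) M
subst-[]₀ s M N = trans (subst-subst s (single N) M)
  (subst-ext (λ { (here refl) → refl ; (there x) → refl }) M)

rename-[]₀ : (r : Ren E F) (M : Term (σ ∷ E) τ) (N : Term E σ) →
             rename r (M [ N ]₀) ≡ rename (liftRen r) M [ rename r N ]₀
rename-[]₀ r M N = trans (rename-subst r (single N) M)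
  (trans (subst-ext (λ { (here refl) → refl ; (there x) → refl }) M)
         (sym (subst-rename (single (rename r N)) (liftRen r) M)))

rename-lift-[]₀ : (r : Ren F G) (s : Sub E F) (M : Term (σ ∷ E) τ) (N : Term G σ) →
                  rename (liftRen r) (subst (liftSub s) M) [ N ]₀ ≡ subst (N ◂ (rename r ∘ s)) M
rename-lift-[]₀ r s M N = begin
  subst (single N) (rename (liftRen r) (subst (liftSub s) M))
    ≡⟨ cong (subst (single N)) (rename-subst (liftRen r) (liftSub s) M) ⟩
  subst (single N) (subst (rename (liftRen r) ∘ liftSub s) M)
    ≡⟨ cong (subst (single N)) (subst-ext (λ { (here p) → refl ; (there x) → rename-weaken r (s x) }) M) ⟩
  subst (single N) (subst (liftSub (rename r ∘ s)) M)
    ≡⟨ subst-lift-[]₀ (rename r ∘ s) M N ⟩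
  subst (N ◂ (rename r ∘ s)) M ∎
  where open ≡-Reasoning

lift-there-[]₀ : (M : Term (σ ∷ E) τ) → rename (liftRen there) M [ var (here refl) ]₀ ≡ M
lift-there-[]₀ M = trans (subst-rename _ _ M)
  (trans (subst-ext (λ { (here refl) → refl ; (there x) → refl }) M) (subst-var M))

≡⇒=βη : {M N : Term E τ} → M ≡ N → M =βη N
≡⇒=βη refl = =refl

rename-=βη : (r : Ren E F) {M N : Term E τ} → M =βη N → rename r M =βη rename r N
rename-=βη r (β M N)      = =trans (β _ _) (≡⇒=βη (sym (rename-[]₀ r M N)))
rename-=βη r (η M)        =
  =trans (ξ (·-cong (≡⇒=βη (rename-weaken r M)) =refl)) (η (rename r M))
rename-=βη r (ξ e)        = ξ (rename-=βη (liftRen r) e)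
rename-=βη r (·-cong e f) = ·-cong (rename-=βη r e) (rename-=βη r f)
rename-=βη r =refl        = =refl
rename-=βη r (=sym e)     = =sym (rename-=βη r e)
rename-=βη r (=trans e f) = =trans (rename-=βη r e) (rename-=βη r f)

-- Long normal forms

infixl 8 _∙_
mutual
  data Nf (E : Env) : Ty → Set where
    lam : Nf (σ ∷ E) τ → Nf E (σ ⇒ τ)
    ne  : Ne E (` a) → Nf E (` a)

  data Ne (E : Env) : Ty → Set where
    var : σ ∈ E → Ne E σ
    _∙_ : Ne E (σ ⇒ τ) → Nf E σ → Ne E τ

mutual
  ⌜_⌝ : Nf E τ → Term E τ
  ⌜ lam m ⌝ = lam ⌜ m ⌝
  ⌜ ne n ⌝  = ⌜ n ⌝ₙ

  ⌜_⌝ₙ : Ne E τ → Term E τ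
  ⌜ var x ⌝ₙ = var x
  ⌜ n ∙ m ⌝ₙ = ⌜ n ⌝ₙ · ⌜ m ⌝

mutual
  renameNf : Ren E F → Nf E τ → Nf F τ
  renameNf r (lam m) = lam (renameNf (liftRen r) m)
  renameNf r (ne n)  = ne (renameNe r n)

  renameNe : Ren E F → Ne E τ → Ne F τ
  renameNe r (var x) = var (r x)
  renameNe r (n ∙ m) = renameNe r n ∙ renameNf r m

mutual
  ⌜renameNf⌝ : (r : Ren E F) (m : Nf E τ) → ⌜ renameNf r m ⌝ ≡ rename r ⌜ m ⌝
  ⌜renameNf⌝ r (lam m) = cong lam (⌜renameNf⌝ (liftRen r) m)
  ⌜renameNf⌝ r (ne n)  = ⌜renameNe⌝ r n

  ⌜renameNe⌝ : (r : Ren E F) (n : Ne E τ) → ⌜ renameNe r n ⌝ₙ ≡ rename r ⌜ n ⌝ₙ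
  ⌜renameNe⌝ r (var x) = refl
  ⌜renameNe⌝ r (n ∙ m) = cong₂ _·_ (⌜renameNe⌝ r n) (⌜renameNf⌝ r m)

-- Weak-head evaluation to long normal forms

infix 4 _↝_ _⇓_ _↓_
data _↝_ {E : Env} : Term E τ → Term E τ → Set where
  β-head : (M : Term (σ ∷ E) τ) (N : Term E σ) → lam M · N ↝ M [ N ]₀
  ·-head : {M M′ : Term E (σ ⇒ τ)} {N : Term E σ} → M ↝ M′ → M · N ↝ M′ · N

mutual
  -- At an arrow type `⇓-lam` applies the term to a fresh variable without inspecting it, so head
  -- reduction is carried out only at atoms and every result is η-long.
  data _⇓_ {E : Env} : Term E τ → Nf E τ → Set where
    ⇓-lam : {M : Term E (σ ⇒ τ)} {m : Nf (σ ∷ E) τ} →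
            weaken M · var (here refl) ⇓ m → M ⇓ lam m
    ⇓-red : {M M′ : Term E (` a)} {m : Nf E (` a)} → M ↝ M′ → M′ ⇓ m → M ⇓ m
    ⇓-ne  : {M : Term E (` a)} {n : Ne E (` a)} → M ↓ n → M ⇓ ne n

  data _↓_ {E : Env} : Term E τ → Ne E τ → Set where
    ↓-var : (x : σ ∈ E) → var x ↓ var x
    ↓-app : {M : Term E (σ ⇒ τ)} {N : Term E σ} {n : Ne E (σ ⇒ τ)} {m : Nf E σ} →
            M ↓ n → N ⇓ m → M · N ↓ n ∙ m

↝-deterministic : {M N P : Term E τ} → M ↝ N → M ↝ P → N ≡ P
↝-deterministic (β-head _ _) (β-head _ _) = refl
↝-deterministic (·-head p)   (·-head q)   = cong (_· _) (↝-deterministic p q)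

↓-irreducible : {M N : Term E τ} {n : Ne E τ} {A : Set} → M ↓ n → M ↝ N → A
↓-irreducible (↓-app d _) (·-head p) = ↓-irreducible d p

mutual
  ⇓-deterministic : {M : Term E τ} {m m′ : Nf E τ} → M ⇓ m → M ⇓ m′ → m ≡ m′
  ⇓-deterministic (⇓-lam d)   (⇓-lam d′)    = cong lam (⇓-deterministic d d′)
  ⇓-deterministic (⇓-red p d) (⇓-red p′ d′) with refl ← ↝-deterministic p p′ = ⇓-deterministic d d′
  ⇓-deterministic (⇓-red p d) (⇓-ne d′)     = ↓-irreducible d′ p
  ⇓-deterministic (⇓-ne d)    (⇓-red p d′)  = ↓-irreducible d p
  ⇓-deterministic (⇓-ne d)    (⇓-ne d′)     = cong ne (↓-deterministic d d′)

  ↓-deterministic : {M : Term E τ} {n n′ : Ne E τ} → M ↓ n → M ↓ n′ → n ≡ n′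
  ↓-deterministic (↓-var x)   (↓-var .x)    = refl
  ↓-deterministic (↓-app d e) (↓-app d′ e′)
    with refl ← ↓-deterministic d d′ | refl ← ⇓-deterministic e e′ = refl

rename-↝ : (r : Ren E F) {M N : Term E τ} → M ↝ N → rename r M ↝ rename r N
rename-↝ r (β-head M N) =
  transport (lam (rename (liftRen r) M) · rename r N ↝_) (sym (rename-[]₀ r M N)) (β-head _ _)
rename-↝ r (·-head p)   = ·-head (rename-↝ r p)

mutual
  rename-⇓ : (r : Ren E F) {M : Term E τ} {m : Nf E τ} → M ⇓ m → rename r M ⇓ renameNf r m
  rename-⇓ r (⇓-lam {M = M} d) =
    ⇓-lam (transport (λ N → N · _ ⇓ _) (rename-weaken r M) (rename-⇓ (liftRen r) d))
  rename-⇓ r (⇓-red p d) = ⇓-red (rename-↝ r p) (rename-⇓ r d)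
  rename-⇓ r (⇓-ne d)    = ⇓-ne (rename-↓ r d)

  rename-↓ : (r : Ren E F) {M : Term E τ} {n : Ne E τ} → M ↓ n → rename r M ↓ renameNe r n
  rename-↓ r (↓-var x)   = ↓-var (r x)
  rename-↓ r (↓-app d e) = ↓-app (rename-↓ r d) (rename-⇓ r e)

↝⇒=βη : {M N : Term E τ} → M ↝ N → M =βη N
↝⇒=βη (β-head M N) = β M N
↝⇒=βη (·-head p)   = ·-cong (↝⇒=βη p) =refl

mutual
  ⇓⇒=βη : {M : Term E τ} {m : Nf E τ} → M ⇓ m → M =βη ⌜ m ⌝
  ⇓⇒=βη (⇓-lam {M = M} d) = =trans (=sym (η M)) (ξ (⇓⇒=βη d))
  ⇓⇒=βη (⇓-red p d)       = =trans (↝⇒=βη p) (⇓⇒=βη d)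
  ⇓⇒=βη (⇓-ne d)          = ↓⇒=βη d

  ↓⇒=βη : {M : Term E τ} {n : Ne E τ} → M ↓ n → M =βη ⌜ n ⌝ₙ
  ↓⇒=βη (↓-var x)   = =refl
  ↓⇒=βη (↓-app d e) = ·-cong (↓⇒=βη d) (⇓⇒=βη e)

⇓-expand : {M N : Term E τ} {m : Nf E τ} → M ↝ N → N ⇓ m → M ⇓ m
⇓-expand p (⇓-lam d)   = ⇓-lam (⇓-expand (·-head (rename-↝ there p)) d)
⇓-expand p (⇓-red q d) = ⇓-red p (⇓-red q d)
⇓-expand p (⇓-ne d)    = ⇓-red p (⇓-ne d)

mutual
  ⌜⌝-⇓ : (m : Nf E τ) → ⌜ m ⌝ ⇓ m
  ⌜⌝-⇓ (lam m) = ⇓-lam (⇓-expand (β-head _ _)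
    (transport (_⇓ m) (sym (lift-there-[]₀ ⌜ m ⌝)) (⌜⌝-⇓ m)))
  ⌜⌝-⇓ (ne n)  = ⇓-ne (⌜⌝-↓ n)

  ⌜⌝-↓ : (n : Ne E τ) → ⌜ n ⌝ₙ ↓ n
  ⌜⌝-↓ (var x) = ↓-var x
  ⌜⌝-↓ (n ∙ m) = ↓-app (⌜⌝-↓ n) (⌜⌝-⇓ m)

-- Normalisation and uniqueness of normal forms

infix 4 _≈_ _≈ₛ_
-- Quantifying over renamings at arrow types lets `≈-reify` test a function on a fresh variable.
_≈_ : Term E τ → Term E τ → Set
_≈_ {τ = ` a}   M N = ∃[ m ] (M ⇓ m × N ⇓ m)
_≈_ {E} {σ ⇒ τ} M N = ∀ {F} (r : Ren E F) {A B : Term F σ} → A ≈ B → rename r M · A ≈ rename r N · B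

≈-expandˡ : {M M′ N : Term E τ} → M ↝ M′ → M′ ≈ N → M ≈ N
≈-expandˡ {τ = ` a}   p (m , d , e) = m , ⇓-red p d , e
≈-expandˡ {τ = σ ⇒ τ} p h r A≈B     = ≈-expandˡ (·-head (rename-↝ r p)) (h r A≈B)

≈-sym : {M N : Term E τ} → M ≈ N → N ≈ M
≈-sym {τ = ` a}   (m , d , e) = m , e , d
≈-sym {τ = σ ⇒ τ} h r A≈B     = ≈-sym (h r (≈-sym A≈B))

≈-trans : {M N P : Term E τ} → M ≈ N → N ≈ P → M ≈ P
≈-trans {τ = ` a}   (m , d , e) (m′ , d′ , e′) with refl ← ⇓-deterministic e d′ = m , d , e′
-- The relation is a priori only partial: `B ≈ B` comes from `A ≈ B` by symmetry and transitivity.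
≈-trans {τ = σ ⇒ τ} h k r A≈B = ≈-trans (h r A≈B) (k r (≈-trans (≈-sym A≈B) A≈B))

≈-rename : (r : Ren E F) {M N : Term E τ} → M ≈ N → rename r M ≈ rename r N
≈-rename {τ = ` a}   r (m , d , e) = renameNf r m , rename-⇓ r d , rename-⇓ r e
≈-rename {τ = σ ⇒ τ} r {M} {N} h s {A} {B} A≈B
  rewrite rename-rename s r M | rename-rename s r N = h (s ∘ r) A≈B

mutual
  ≈-reflect : {M N : Term E τ} {n : Ne E τ} → M ↓ n → N ↓ n → M ≈ N
  ≈-reflect {τ = ` a}   {n = n} d e = ne n , ⇓-ne d , ⇓-ne e
  ≈-reflect {τ = σ ⇒ τ} d e r A≈B with m , p , q ← ≈-reify A≈B =
    ≈-reflect (↓-app (rename-↓ r d) p) (↓-app (rename-↓ r e) q)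

  ≈-reify : {M N : Term E τ} → M ≈ N → ∃[ m ] (M ⇓ m × N ⇓ m)
  ≈-reify {τ = ` a}   h = h
  ≈-reify {τ = σ ⇒ τ} h
    with m , d , e ← ≈-reify (h there (≈-reflect (↓-var (here refl)) (↓-var (here refl)))) =
    lam m , ⇓-lam d , ⇓-lam e

_≈ₛ_ : Sub E F → Sub E F → Set
_≈ₛ_ {E} s t = ∀ {σ} (x : σ ∈ E) → s x ≈ t x

◂-≈ₛ : {s t : Sub E F} {M N : Term F σ} → M ≈ N → s ≈ₛ t → (M ◂ s) ≈ₛ (N ◂ t)
◂-≈ₛ M≈N h (here refl) = M≈N
◂-≈ₛ M≈N h (there x)   = h x

≈-lam : (s t : Sub E F) (M N : Term (σ ∷ E) τ) →
        (∀ {G} (r : Ren F G) {A B : Term G σ} → A ≈ B →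
           subst (A ◂ (rename r ∘ s)) M ≈ subst (B ◂ (rename r ∘ t)) N) →
        subst s (lam M) ≈ subst t (lam N)
≈-lam s t M N h r {A} {B} A≈B =
  ≈-expandˡ (β-head _ _) (≈-sym (≈-expandˡ (β-head _ _) (≈-sym goal)))
  where
  goal : (rename (liftRen r) (subst (liftSub s) M) [ A ]₀) ≈
         (rename (liftRen r) (subst (liftSub t) N) [ B ]₀)
  goal rewrite rename-lift-[]₀ r s M A | rename-lift-[]₀ r t N B = h r A≈B

rename-id : (M : Term E τ) → rename id M ≡ M
rename-id M = trans (sym (subst-var∘ id M)) (subst-var M)

≈-subst : {s t : Sub E F} → s ≈ₛ t → (M : Term E τ) → subst s M ≈ subst t M
≈-subst h (var x) = h x
≈-subst {s = s} {t} h (lam M) =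
  ≈-lam s t M M (λ r A≈B → ≈-subst (◂-≈ₛ A≈B (λ x → ≈-rename r (h x))) M)
≈-subst {s = s} {t} h (M · N) =
  transport (λ P → P · subst s N ≈ subst t (M · N)) (rename-id (subst s M))
    (transport (λ P → _ ≈ P · subst t N) (rename-id (subst t M))
      (≈-subst h M id (≈-subst h N)))

-- Fundamental lemma. There are two substitutions because under `ξ` the bound variable receives two
-- related arguments.
=βη⇒≈ : {s t : Sub E F} {M N : Term E τ} → s ≈ₛ t → M =βη N → subst s M ≈ subst t N
=βη⇒≈ {s = s} {t} h (β M N) = ≈-expandˡ (β-head _ _) goal
  where
  goal : (subst (liftSub s) M [ subst s N ]₀) ≈ subst t (M [ N ]₀)
  goal rewrite subst-lift-[]₀ s M (subst s N) | subst-[]₀ t M N =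
    ≈-subst (◂-≈ₛ (≈-subst h N) h) M
=βη⇒≈ {s = s} {t} h (η M) r {A} {B} A≈B = ≈-expandˡ (β-head _ _) goal
  where
  goal : (rename (liftRen r) (subst (liftSub s) (weaken M · var (here refl))) [ A ]₀)
         ≈ rename r (subst t M) · B
  goal rewrite rename-lift-[]₀ r s (weaken M) A
             | subst-rename (A ◂ (rename r ∘ s)) there M
             | sym (rename-subst r s M) = ≈-subst h M r A≈B
=βη⇒≈ {s = s} {t} h (ξ {M = M} {N} e) =
  ≈-lam s t M N (λ r A≈B → =βη⇒≈ (◂-≈ₛ A≈B (λ x → ≈-rename r (h x))) e)
=βη⇒≈ {s = s} {t} h (·-cong {M = M} {M′} {N} {N′} e f) =
  transport (λ P → P · subst s N ≈ subst t (M′ · N′)) (rename-id (subst s M))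
    (transport (λ P → _ ≈ P · subst t N′) (rename-id (subst t M′))
      (=βη⇒≈ h e id (=βη⇒≈ h f)))
=βη⇒≈ h (=refl {M = M}) = ≈-subst h M
=βη⇒≈ h (=sym e)        = ≈-sym (=βη⇒≈ (λ x → ≈-sym (h x)) e)
=βη⇒≈ h (=trans e f)    =
  ≈-trans (=βη⇒≈ h e) (=βη⇒≈ (λ x → ≈-trans (≈-sym (h x)) (h x)) f)

=βη⇒⇓ : {M N : Term E τ} → M =βη N → ∃[ m ] (M ⇓ m × N ⇓ m)
=βη⇒⇓ {M = M} {N} e with m , d , d′ ← ≈-reify (=βη⇒≈ (λ x → ≈-reflect (↓-var x) (↓-var x)) e) =
  m , transport (_⇓ m) (subst-var M) d , transport (_⇓ m) (subst-var N) d′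

nf : Term E τ → Nf E τ
nf M = proj₁ (=βη⇒⇓ (=refl {M = M}))

nf-=βη : (M : Term E τ) → M =βη ⌜ nf M ⌝
nf-=βη M = ⇓⇒=βη (proj₁ (proj₂ (=βη⇒⇓ (=refl {M = M}))))

-- Long normal forms evaluate to themselves, and βη-equal terms evaluate to a common normal form.
⌜⌝-injective : (m m′ : Nf E τ) → ⌜ m ⌝ =βη ⌜ m′ ⌝ → m ≡ m′
⌜⌝-injective m m′ e with _ , d , d′ ← =βη⇒⇓ e =
  trans (⇓-deterministic (⌜⌝-⇓ m) d) (⇓-deterministic d′ (⌜⌝-⇓ m′))

-- η-expansion of neutral terms

etaExpand : ∀ τ → Ne E τ → Nf E τ
etaExpand (` a)   n = ne n
etaExpand (σ ⇒ τ) n = lam (etaExpand τ (renameNe there n ∙ etaExpand σ (var (here refl))))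

etaExpand-=βη : ∀ τ (n : Ne E τ) → ⌜ etaExpand τ n ⌝ =βη ⌜ n ⌝ₙ
etaExpand-=βη (` a)   n = =refl
etaExpand-=βη (σ ⇒ τ) n = =trans
  (ξ (=trans (etaExpand-=βη τ _) (·-cong (≡⇒=βη (⌜renameNe⌝ there n)) (etaExpand-=βη σ _))))
  (η ⌜ n ⌝ₙ)

-- Terms that a renaming sends to a variable

there-injective : {x y : σ ∈ E} → there {x = τ} x ≡ there y → x ≡ y
there-injective refl = refl

lam-injective : {m m′ : Nf (σ ∷ E) τ} → Nf.lam m ≡ lam m′ → m ≡ m′
lam-injective refl = refl

ne-injective : {n n′ : Ne E (` a)} → ne n ≡ ne n′ → n ≡ n′
ne-injective refl = refl

var-injective : {x y : σ ∈ E} → Ne.var x ≡ var y → x ≡ y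
var-injective refl = refl

∙-injective : ∀ {σ σ′} {n : Ne E (σ ⇒ τ)} {n′ : Ne E (σ′ ⇒ τ)} {m m′} → n ∙ m ≡ n′ ∙ m′ →
              ∃[ p ] (transport (λ σ → Ne E (σ ⇒ τ)) p n ≡ n′ × transport (Nf E) p m ≡ m′)
∙-injective refl = refl , refl , refl

-- Existence half of the universal property of a pullback. For inclusions it reads: what lives in
-- both `F` and `G` already lives in `H`.
IsPullback : Ren F E → Ren G E → Ren H F → Ren H G → Set
IsPullback r s p q = ∀ {σ} x y → r {σ} x ≡ s y → ∃[ z ] (x ≡ p z × y ≡ q z)

liftRen-pullback : {r : Ren F E} {s : Ren G E} {p : Ren H F} {q : Ren H G} → IsPullback r s p q →
  IsPullback (liftRen {σ = τ} r) (liftRen s) (liftRen p) (liftRen q)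
liftRen-pullback h (here x)  (here .x) refl = here x , refl , refl
liftRen-pullback h (there x) (there y) e with z , refl , refl ← h x y (there-injective e) =
  there z , refl , refl

mutual
  renameNf-pullback : {r : Ren F E} {s : Ren G E} {p : Ren H F} {q : Ren H G} → IsPullback r s p q →
    (m : Nf F τ) (m′ : Nf G τ) → renameNf r m ≡ renameNf s m′ →
    ∃[ m₀ ] (m ≡ renameNf p m₀ × m′ ≡ renameNf q m₀)
  renameNf-pullback {r = r} {s} {p} {q} h (lam m) (lam m′) e
    with m₀ , refl , refl ←
           renameNf-pullback (liftRen-pullback {r = r} {s} {p} {q} h) m m′ (lam-injective e) =
    lam m₀ , refl , refl
  renameNf-pullback {r = r} {s} {p} {q} h (ne n) (ne n′) e
    with n₀ , refl , refl ← renameNe-pullback {r = r} {s} {p} {q} h n n′ (ne-injective e) =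
    ne n₀ , refl , refl

  renameNe-pullback : {r : Ren F E} {s : Ren G E} {p : Ren H F} {q : Ren H G} → IsPullback r s p q →
    (n : Ne F τ) (n′ : Ne G τ) → renameNe r n ≡ renameNe s n′ →
    ∃[ n₀ ] (n ≡ renameNe p n₀ × n′ ≡ renameNe q n₀)
  renameNe-pullback h (var x) (var y) e
    with z , refl , refl ← h x y (var-injective e) = var z , refl , refl
  renameNe-pullback {r = r} {s} {p} {q} h (n ∙ m) (n′ ∙ m′) e
    with refl , e₁ , e₂ ← ∙-injective e
    with n₀ , refl , refl ← renameNe-pullback {r = r} {s} {p} {q} h n n′ e₁
       | m₀ , refl , refl ← renameNf-pullback {r = r} {s} {p} {q} h m m′ e₂ = n₀ ∙ m₀ , refl , refl

-- Renaming reflects η-expansions: under the λ, only the bound variable is sent to the bound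
-- variable, and a head that avoids it after renaming avoided it before.
renameNf-etaExpand : (r : Ren E F) (m : Nf E τ) (n′ : Ne F τ) → renameNf r m ≡ etaExpand τ n′ →
                     ∃[ n ] (renameNe r n ≡ n′ × m ≡ etaExpand τ n)
renameNf-etaExpand r (ne n)  n′ e = n , ne-injective e , refl
renameNf-etaExpand {τ = σ ⇒ τ} r (lam m) n′ e
  with renameNf-etaExpand (liftRen r) m _ (lam-injective e)
... | n ∙ k , e′ , refl
  with refl , e₁ , e₂ ← ∙-injective e′
  with renameNf-etaExpand (liftRen r) k _ e₂
... | var (here refl) , refl , refl
  -- The image of `n` under `liftRen r` is a weakening; the pullback of `liftRen r` and `there`
  -- shows that `n` is one too.
  with n₀ , refl , refl ← renameNe-pullback {p = there} {q = r}
         (λ { (there x) y refl → x , refl , refl }) n n′ e₁ = n₀ , refl , refl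

rename-to-var : (r : Ren E F) (M : Term E τ) {y : τ ∈ F} → rename r M =βη var y →
                ∃[ x ] (r x ≡ y × M =βη var x)
rename-to-var {τ = τ} r M {y} e
  with renameNf-etaExpand r (nf M) (var y) (⌜⌝-injective _ _ (=trans (≡⇒=βη (⌜renameNf⌝ r (nf M)))
         (=trans (rename-=βη r (=sym (nf-=βη M))) (=trans e (=sym (etaExpand-=βη τ (var y)))))))
... | var x , refl , eq = x , refl , =trans (nf-=βη M) (=trans (≡⇒=βη (cong ⌜_⌝ eq)) (etaExpand-=βη τ (var x)))

-- Spines

infixr 5 _⟨_⟩∷_
infixl 7 _·ₛ_
-- `Q` labels the argument types; it is later `Delayed`.
data Spine (Q : Ty → Set) (E : Env) : Ty → Ty → Set where
  []     : Spine Q E τ τ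
  _⟨_⟩∷_ : Term E σ → Q σ → Spine Q E τ θ → Spine Q E (σ ⇒ τ) θ

private variable
  Q : Ty → Set

_·ₛ_ : Term E τ → Spine Q E τ θ → Term E θ
M ·ₛ []            = M
M ·ₛ (N ⟨ _ ⟩∷ S) = M · N ·ₛ S

mapSpine : (∀ {σ} → Term E σ → Term F σ) → Spine Q E τ θ → Spine Q F τ θ
mapSpine f []            = []
mapSpine f (N ⟨ q ⟩∷ S) = f N ⟨ q ⟩∷ mapSpine f S

mapSpine-·ₛ : (f : ∀ {σ} → Term E σ → Term F σ) →
              (∀ {σ τ} (M : Term E (σ ⇒ τ)) N → f (M · N) ≡ f M · f N) →
              (M : Term E τ) (S : Spine Q E τ θ) → f (M ·ₛ S) ≡ f M ·ₛ mapSpine f S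
mapSpine-·ₛ f h M []            = refl
mapSpine-·ₛ f h M (N ⟨ _ ⟩∷ S) = trans (mapSpine-·ₛ f h (M · N) S) (cong (_·ₛ mapSpine f S) (h M N))

mapSpine-∘ : {f : ∀ {σ} → Term F σ → Term G σ} {g : ∀ {σ} → Term E σ → Term F σ}
             {h : ∀ {σ} → Term E σ → Term G σ} → (∀ {σ} (N : Term E σ) → f (g N) ≡ h N) →
             (S : Spine Q E τ θ) → mapSpine f (mapSpine g S) ≡ mapSpine h S
mapSpine-∘ e []            = refl
mapSpine-∘ e (N ⟨ q ⟩∷ S) = cong₂ (_⟨ q ⟩∷_) (e N) (mapSpine-∘ e S)

mapSpine-id : (S : Spine Q E τ θ) → mapSpine id S ≡ S
mapSpine-id []            = refl
mapSpine-id (N ⟨ q ⟩∷ S) = cong (N ⟨ q ⟩∷_) (mapSpine-id S)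

·ₛ-cong : {M N : Term E τ} → M =βη N → (S : Spine Q E τ θ) → M ·ₛ S =βη N ·ₛ S
·ₛ-cong e []            = e
·ₛ-cong e (_ ⟨ _ ⟩∷ S) = ·ₛ-cong (·-cong e =refl) S

contract : Ren (σ ∷ σ ∷ E) (σ ∷ E)
contract (here p)  = here p
contract (there x) = x

exchange : Ren (σ ∷ τ ∷ E) (τ ∷ σ ∷ E)
exchange (here p)          = there (here p)
exchange (there (here p))  = here p
exchange (there (there x)) = there (there x)

-- The occurrences of the fresh variable in the first argument N and those in
-- the other arguments S are given different names; the result is then one of
-- the two.  If it is the name used in N, then N is a coder; otherwise N can be
-- moved into the head, which does not mention the fresh variable.
retract-of-spine-type : ∀ κ (M : Term E κ) (S : Spine Q (ρ ∷ E) κ ρ) →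
  weaken M ·ₛ S =βη var (here refl) → ∃[ σ ] (Q σ × ρ ⊴ σ)
retract-of-spine-type κ M [] e with () ← proj₁ (proj₂ (rename-to-var there M e))
retract-of-spine-type {E} {Q} {ρ} (σ ⇒ κ) M (N ⟨ q ⟩∷ S) e
  -- Index 1 names the fresh variable in `N`, index 0 names it in `S`; `contract` merges the two
  -- names again.
  with rename-to-var contract (weaken (weaken M · N) ·ₛ mapSpine (rename (liftRen there)) S)
         (=trans (≡⇒=βη contracted) e)
  where
  contracted : rename contract (weaken (weaken M · N) ·ₛ mapSpine (rename (liftRen there)) S) ≡
               weaken M · N ·ₛ S
  contracted = trans (mapSpine-·ₛ (rename contract) (λ _ _ → refl) _ (mapSpine _ S))
    (cong₂ _·ₛ_ (trans (rename-rename contract there (weaken M · N)) (rename-id _))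
      (trans (mapSpine-∘ (λ P → trans (rename-rename _ _ P)
               (trans (rename-ext (λ { (here p) → refl ; (there x) → refl }) P) (rename-id P))) S)
             (mapSpine-id S)))
... | here refl , _ , e′ =
  retract-of-spine-type κ (weaken M · N) (mapSpine (rename (liftRen there)) S) e′
-- The name from `S` is declared in `env`, the name from `N` becomes the coder's variable. They now
-- stand in the opposite order, hence `exchange`.
... | there .(here refl) , refl , e′ = σ , q , record
  { env     = ρ ∷ E
  ; coder   = coder
  ; decoder = lam body
  ; retract = =trans (β _ coder) (=trans (≡⇒=βη reduct) (rename-=βη exchange e′))
  }
  where
  coder : Term (ρ ∷ ρ ∷ E) σ
  coder = rename (liftRen there) N

  body : Term (σ ∷ ρ ∷ E) ρ
  body = weaken (weaken M) · var (here refl) ·ₛ mapSpine weaken S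

  subst-weaken : (P : Term (ρ ∷ E) τ) → subst (single coder ∘ liftRen there) (weaken P) ≡ weaken P
  subst-weaken P = trans (subst-rename (single coder ∘ liftRen there) there P) (subst-var∘ there P)

  reduct : rename (liftRen there) body [ coder ]₀ ≡
           rename exchange (weaken (weaken M · N) ·ₛ mapSpine (rename (liftRen there)) S)
  reduct = begin
    rename (liftRen there) body [ coder ]₀
      ≡⟨ subst-rename (single coder) (liftRen there) body ⟩
    subst (single coder ∘ liftRen there) body
      ≡⟨ mapSpine-·ₛ (subst (single coder ∘ liftRen there)) (λ _ _ → refl) _ (mapSpine weaken S) ⟩
    subst (single coder ∘ liftRen there) (weaken (weaken M)) · coder
      ·ₛ mapSpine (subst (single coder ∘ liftRen there)) (mapSpine weaken S)
      ≡⟨ cong₂ (λ P → P · coder ·ₛ_) (subst-weaken (weaken M)) (mapSpine-∘ subst-weaken S) ⟩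
    weaken (weaken M) · coder ·ₛ mapSpine weaken S
      ≡⟨ cong₂ _·ₛ_
           (cong₂ _·_ (trans (rename-rename _ _ M)
                             (sym (trans (cong (rename exchange) (rename-rename _ _ M)) (rename-rename _ _ M))))
                      (sym (trans (rename-rename _ _ N)
                                  (rename-ext (λ { (here p) → refl ; (there x) → refl }) N))))
           (sym (mapSpine-∘ (λ P → trans (rename-rename _ _ P)
                               (rename-ext (λ { (here p) → refl ; (there x) → refl }) P)) S)) ⟩
    rename exchange (weaken (weaken M · N)) ·ₛ mapSpine (rename exchange) (mapSpine (rename (liftRen there)) S)
      ≡⟨ mapSpine-·ₛ (rename exchange) (λ _ _ → refl) _ (mapSpine (rename (liftRen there)) S) ⟨
    rename exchange (weaken (weaken M · N) ·ₛ mapSpine (rename (liftRen there)) S) ∎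
    where open ≡-Reasoning

-- The play between coder and decoder

-- Paths list the innermost letter first: `nested` adds a letter at the outer end, while the play
-- descends and adds one at the inner end.
Part-extend : ∀ {w} → Part σ w τ → θ ∈ args σ → Part θ (head σ ∷ w) τ
Part-extend (arg σ∈τ)      θ∈σ = nested σ∈τ (arg θ∈σ)
Part-extend (nested i∈τ p) θ∈σ = nested i∈τ (Part-extend p θ∈σ)

-- In Γ ++ ρ ∷ E every variable is "other" than the variable of type ρ between Γ and E.
other-variable : ∀ Γ → σ ∈ Γ ++ ρ ∷ E → Bool
other-variable []      (here p)  = false
other-variable []      (there x) = true
other-variable (θ ∷ Γ) (here p)  = true
other-variable (θ ∷ Γ) (there x) = other-variable Γ x

other-variable-left : ∀ Γ (x : σ ∈ Γ) → other-variable {ρ = ρ} {E} Γ (∈-++⁺ˡ x) ≡ true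
other-variable-left (θ ∷ Γ) (here refl) = refl
other-variable-left (θ ∷ Γ) (there x)   = other-variable-left Γ x

other-variable-right : ∀ Γ (x : σ ∈ ρ ∷ E) →
  other-variable {ρ = ρ} {E} Γ (∈-++⁺ʳ Γ x) ≡ other-variable [] x
other-variable-right []      x = refl
other-variable-right (θ ∷ Γ) x = other-variable-right Γ x

-- Moves the chosen variable to a new front position and leaves its old slot vacant, so the renaming
-- acts as a weakening on terms that avoid `Γ`.
isolate : ∀ {Γ} → σ ∈ Γ → Ren (Γ ++ E) (σ ∷ Γ ++ E)
isolate (here refl) (here refl) = here refl
isolate (here refl) (there x)   = there (there x)
isolate (there i)   (here p)    = there (here p)
isolate (there i)   (there x)   = liftRen there (isolate i x)

isolate-left : ∀ {Γ} (i : σ ∈ Γ) → isolate {E = E} i (∈-++⁺ˡ i) ≡ here refl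
isolate-left (here refl) = refl
isolate-left (there i)   = cong (liftRen there) (isolate-left i)

isolate-right : ∀ {Γ} (i : σ ∈ Γ) (x : θ ∈ E) → isolate i (∈-++⁺ʳ Γ x) ≡ there (∈-++⁺ʳ Γ x)
isolate-right (here refl) x = refl
isolate-right (there i)   x = cong (liftRen there) (isolate-right i x)

module Decoding (ρ τ : Ty) (E : Env) where

  Delayed : Ty → Set
  Delayed σ = ∃[ m ] Part σ (replicate (1 + 2 * m) (head ρ)) τ

  private
    -- The coder's context ρ ∷ E, extended by the arguments yᵢ to which x is applied.
    Φ : Env
    Φ = args ρ ++ ρ ∷ E

    embed : Ren (ρ ∷ E) Φ
    embed = ∈-++⁺ʳ (args ρ)

  -- `N` is `Pᵢ` abstracted over the variables bound by the coder, and `S` lists the decoder terms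
  -- put in their place. `N` lives in the coder's context and so avoids every `yᵢ`.
  data Coded (M : Term Φ σ) : Set where
    coded : (N : Term (ρ ∷ E) κ) (S : Spine Delayed Φ κ σ) →
            M =βη rename embed N ·ₛ S → Coded M

  AllCoded : Ne Φ σ → Set
  AllCoded (var x) = ⊤
  AllCoded (n ∙ m) = AllCoded n × Coded ⌜ m ⌝

  headOther : Ne Φ σ → Bool
  headOther (var x) = other-variable (args ρ) x
  headOther (n ∙ m) = headOther n

  -- The cases correspond to a play that ends at a variable other than `x` and one that ends at `x`.
  -- The latter passes through the coder, which is analysed only if the heads agree; hence the
  -- equality.
  Good : Ne Φ σ → Set
  Good n = headOther n ≡ true ⊎ (head ρ ≡ head τ × AllCoded n)

  -- Base types other than head ρ carry no information, so a part of τ matters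
  -- only if its path continues with the atom head ρ.
  Red : ∀ σ → Term Φ σ → Set
  Red (` b)   M = b ≡ head ρ → ∃[ n ] (M =βη ⌜ n ⌝ₙ × Good n)
  Red (σ ⇒ θ) M = ∀ {N} → Red σ N → Red θ (M · N)

  Red-resp : ∀ σ {M N : Term Φ σ} → M =βη N → Red σ N → Red σ M
  Red-resp (` b)   e h b≡ with n , f , g ← h b≡ = n , =trans e f , g
  Red-resp (σ ⇒ θ) e h r  = Red-resp θ (·-cong e =refl) (h r)

  Red-off-head : ∀ σ {M : Term Φ σ} → head σ ≢ head ρ → Red σ M
  Red-off-head (` b)   h b≡ = ⊥-elim (h b≡)
  Red-off-head (σ ⇒ θ) h r  = Red-off-head θ h

  Red-other : ∀ σ (n : Ne Φ σ) → headOther n ≡ true → Red σ ⌜ n ⌝ₙ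
  Red-other (` b)   n h _     = n , =refl , inj₁ h
  Red-other (σ ⇒ θ) n h {N} r =
    Red-resp θ (·-cong =refl (nf-=βη N)) (Red-other θ (n ∙ nf N) h)

  Red-subst : {s : Sub Δ Φ} → (∀ {σ} (x : σ ∈ Δ) → Red σ (s x)) →
              (M : Term Δ σ) → Red σ (subst s M)
  Red-subst h (var x) = h x
  Red-subst {s = s} h (lam {τ = θ} M) {N} r =
    Red-resp θ (=trans (β _ N) (≡⇒=βη (subst-lift-[]₀ s M N)))
      (Red-subst (λ { (here refl) → r ; (there x) → h x }) M)
  Red-subst h (M · N) = Red-subst h M (Red-subst h N)

  -- Coder contexts met in the play: the variables bound by the coder have
  -- delayed types and are instantiated by reducible decoder terms.
  data Closing : Env → Set where
    base : Closing (ρ ∷ E)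
    push : (N : Term Φ σ) → Delayed σ → Red σ N → Closing Δ → Closing (σ ∷ Δ)

  close : Closing Δ → Sub Δ Φ
  close base           = var ∘ embed
  close (push N _ _ γ) = N ◂ close γ

  -- A β-expansion takes each pushed decoder term out of the substitution and puts it at the front
  -- of the spine.
  close-coded : (γ : Closing Δ) (M : Term Δ κ) (S : Spine Delayed Φ κ σ) →
                Coded (subst (close γ) M ·ₛ S)
  close-coded base           M S = coded M S (≡⇒=βη (cong (_·ₛ S) (subst-var∘ embed M)))
  close-coded (push N d _ γ) M S with coded P U e ← close-coded γ (lam M) (N ⟨ d ⟩∷ S) =
    coded P U (=trans (·ₛ-cong (=sym (=trans (β _ N) (≡⇒=βη (subst-lift-[]₀ (close γ) M N)))) S) e)

  Coded-resp : {M N : Term Φ σ} → M =βη N → Coded N → Coded M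
  Coded-resp e (coded P S f) = coded P S (=trans e f)

  close-var : (γ : Closing Δ) (x : σ ∈ Δ) →
              (Delayed σ × Red σ (close γ x)) ⊎ ∃[ y ] close γ x ≡ var (embed y)
  close-var base           x           = inj₂ (x , refl)
  close-var (push N d r γ) (here refl) = inj₁ (d , r)
  close-var (push N d r γ) (there x)   = close-var γ x

  -- Parity of paths and reducibility of the coder

  EvenPart : Ty → Set
  EvenPart σ = ∃[ m ] Part σ (replicate (2 + 2 * m) (head ρ)) τ

  Delayed⇒EvenPart : head σ ≡ head ρ → Delayed σ → θ ∈ args σ → EvenPart θ
  Delayed⇒EvenPart e (m , p) θ∈σ =
    m , transport (λ a → Part _ (a ∷ replicate (1 + 2 * m) (head ρ)) τ) e (Part-extend p θ∈σ)

  EvenPart⇒Delayed : head σ ≡ head ρ → EvenPart σ → θ ∈ args σ → Delayed θ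
  EvenPart⇒Delayed {θ = θ} e (m , p) θ∈σ =
    suc m , transport (λ k → Part θ (replicate (suc k) (head ρ)) τ) (sym (*-suc 2 m))
      (transport (λ a → Part _ (a ∷ replicate (2 + 2 * m) (head ρ)) τ) e (Part-extend p θ∈σ))

  module _ (ρ≡τ : head ρ ≡ head τ) where
    mutual
      -- The coder mentions `x`, whose reducibility is derived from that of the coder, so
      -- `Red-subst` would be circular. Induction on long normal forms tracks the parity of paths
      -- instead.
      Red-nf : (γ : Closing Δ) (m : Nf Δ σ) → head σ ≡ head ρ → (∀ {θ} → θ ∈ args σ → Delayed θ) →
               Red σ (subst (close γ) ⌜ m ⌝)
      Red-nf γ (lam {τ = θ} m) e d {N} r =
        Red-resp θ (=trans (β _ N) (≡⇒=βη (subst-lift-[]₀ (close γ) ⌜ m ⌝ N)))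
          (Red-nf (push N (d (here refl)) r γ) m e (d ∘ there))
      Red-nf γ (ne n) e d with Red-ne γ n e
      ... | inj₁ (r , _)       = r
      ... | inj₂ (n′ , e′ , g) = λ _ → n′ , e′ , g

      -- In the first case the head is bound by the coder and the play passes to a decoder term. In
      -- the second it is `x` or a variable of `E`, which closing leaves in place, so the term stays
      -- neutral.
      Red-ne : (γ : Closing Δ) (n : Ne Δ σ) → head σ ≡ head ρ →
               (Red σ (subst (close γ) ⌜ n ⌝ₙ) × (∀ {θ} → θ ∈ args σ → EvenPart θ)) ⊎
               ∃[ n′ ] (subst (close γ) ⌜ n ⌝ₙ =βη ⌜ n′ ⌝ₙ × Good n′)
      Red-ne γ (var x) e with close-var γ x
      ... | inj₁ (d , r)          = inj₁ (r , Delayed⇒EvenPart e d)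
      ... | inj₂ (here refl , eq) = inj₂ (var _ , ≡⇒=βη eq , inj₂ (ρ≡τ , tt))
      ... | inj₂ (there y , eq)   =
        inj₂ (var _ , ≡⇒=βη eq , inj₁ (other-variable-right (args ρ) (there y)))
      Red-ne γ (_∙_ {σ = σ} n m) e with Red-ne γ n e
      ... | inj₂ (n′ , e′ , g) = inj₂ (n′ ∙ nf N , ·-cong e′ (nf-=βη N) , extend g)
        where
        N : Term Φ σ
        N = subst (close γ) ⌜ m ⌝
        extend : Good n′ → Good (n′ ∙ nf N)
        extend (inj₁ h)        = inj₁ h
        -- The new argument is a closed coder term: `close-coded` starts from an empty spine and
        -- collects the decoder terms in it.
        extend (inj₂ (h , cs)) =
          inj₂ (h , cs , Coded-resp (=sym (nf-=βη N)) (close-coded γ ⌜ m ⌝ []))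
      -- An argument type with another head would break the one-letter path, but reducibility at
      -- such a type is vacuous.
      ... | inj₁ (r , d) with head σ ≟ head ρ
      ...   | yes σ≡ρ = inj₁ (r (Red-nf γ m σ≡ρ (EvenPart⇒Delayed σ≡ρ (d (here refl)))) , d ∘ there)
      ...   | no  σ≢ρ = inj₁ (r (Red-off-head σ σ≢ρ) , d ∘ there)

  Red-coder : (C : Term (ρ ∷ E) τ) → Red τ (rename embed C)
  Red-coder C with head τ ≟ head ρ
  ... | no  τ≢ρ = Red-off-head τ τ≢ρ
  ... | yes τ≡ρ = Red-resp τ
    (=trans (rename-=βη embed (nf-=βη C)) (≡⇒=βη (sym (subst-var∘ embed ⌜ nf C ⌝))))
    (Red-nf (sym τ≡ρ) base (nf C) τ≡ρ
      -- Arguments of `τ` itself have a path of length one, so `m` is 0.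
      (λ θ∈τ → 0 , transport (λ a → Part _ (a ∷ []) τ) τ≡ρ (arg θ∈τ)))

  -- Reading off the arguments of `x`

  -- Used to form `x y₁ … yℓ`; its arguments are η-expanded so that it is long normal and can be
  -- compared syntactically with the neutral term given by `Red`.
  applyTo : (∀ {σ} → σ ∈ args κ → σ ∈ Φ) → Ne Φ κ → Ne Φ (` head κ)
  applyTo {` b}   f n = n
  applyTo {σ ⇒ κ} f n = applyTo (f ∘ there) (n ∙ etaExpand σ (var (f (here refl))))

  Red-applyTo : ∀ κ (f : ∀ {σ} → σ ∈ args κ → σ ∈ Φ) →
                (∀ {σ} (i : σ ∈ args κ) → other-variable (args ρ) (f i) ≡ true) →
                (n : Ne Φ κ) → Red κ ⌜ n ⌝ₙ → Red (` head κ) ⌜ applyTo f n ⌝ₙ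
  Red-applyTo (` b)   f h n r = r
  Red-applyTo (σ ⇒ κ) f h n r = Red-applyTo κ (f ∘ there) (h ∘ there) _
    (r (Red-resp σ (etaExpand-=βη σ _) (Red-other σ (var (f (here refl))) (h (here refl)))))

  headOther-applyTo : ∀ κ (f : ∀ {σ} → σ ∈ args κ → σ ∈ Φ) (n : Ne Φ κ) →
                      headOther (applyTo f n) ≡ headOther n
  headOther-applyTo (` b)   f n = refl
  headOther-applyTo (σ ⇒ κ) f n = headOther-applyTo κ (f ∘ there) _

  AllCoded-applyTo : ∀ κ (f : ∀ {σ} → σ ∈ args κ → σ ∈ Φ) (n : Ne Φ κ) → AllCoded (applyTo f n) →
                     AllCoded n × (∀ {σ} (i : σ ∈ args κ) → Coded (var (f i)))
  AllCoded-applyTo (` b)   f n cs = cs , λ ()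
  AllCoded-applyTo (σ ⇒ κ) f n cs
    with (cs′ , c) , cs″ ← AllCoded-applyTo κ (f ∘ there) _ cs =
    cs′ , λ { (here refl) → Coded-resp (=sym (etaExpand-=βη σ _)) c ; (there i) → cs″ i }

  module _ (C : Term (ρ ∷ E) τ) (D : Term E (τ ⇒ ρ)) (DC=x : weaken D · C =βη var (here refl)) where

    -- By the retraction equation `x` is the decoder applied to the coder. The decoder is reducible
    -- by `Red-subst`, since its free variables lie in `E`, and the coder by `Red-coder`.
    Red-root : Red ρ (var (embed (here refl)))
    Red-root = Red-resp ρ (=trans (=sym (rename-=βη embed DC=x)) (·-cong (≡⇒=βη
                 (trans (rename-rename embed there D) (sym (subst-var∘ (embed ∘ there) D)))) =refl))
      (Red-subst (λ x → Red-other _ (var (embed (there x)))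
                                  (other-variable-right (args ρ) (there x))) D
        (Red-coder C))

    arguments-coded : head ρ ≡ head τ × (∀ {σ} (i : σ ∈ args ρ) → Coded (var (∈-++⁺ˡ i)))
    arguments-coded
      with n , e , g ← Red-applyTo ρ ∈-++⁺ˡ (other-variable-left (args ρ))
                         (var (embed (here refl))) Red-root refl
      -- By uniqueness of long normal forms the reducibility witness is `x y₁ … yℓ` itself; its head
      -- is `x`, which excludes the first case of `Good`.
      with refl ← ⌜⌝-injective (ne _) (ne n) e
      with g
    ... | inj₁ h with () ← trans (sym h) (trans (headOther-applyTo ρ ∈-++⁺ˡ _)
                                                (other-variable-right (args ρ) (here refl)))
    ... | inj₂ (h , cs) = h , proj₂ (AllCoded-applyTo ρ ∈-++⁺ˡ _ cs)

  -- Since `N` avoids every `yᵢ`, isolating one of them makes the head a weakening, as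
  -- `retract-of-spine-type` requires.
  Coded⇒⊴ : (i : σ ∈ args ρ) → Coded (var (∈-++⁺ˡ i)) → ∃[ θ ] (Delayed θ × σ ⊴ θ)
  Coded⇒⊴ {σ} i (coded {κ = κ} N S e) =
    retract-of-spine-type κ (rename embed N) (mapSpine (rename (isolate i)) S)
      (=trans (≡⇒=βη (trans (cong (_·ₛ mapSpine (rename (isolate i)) S) isolated)
                            (sym (mapSpine-·ₛ (rename (isolate i)) (λ _ _ → refl) _ S))))
        (=trans (=sym (rename-=βη (isolate i) e)) (≡⇒=βη (cong var (isolate-left i)))))
    where
    isolated : weaken (rename embed N) ≡ rename (isolate i) (rename embed N)
    isolated = trans (rename-rename there embed N)
      (trans (sym (rename-ext (isolate-right i) N)) (sym (rename-rename (isolate i) embed N)))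

theorem4p4 : (ρ τ : Ty) → ρ ⊴ τ →
    (head ρ ≡ head τ) ×
    (∀ ρᵢ → ρᵢ ∈ args ρ → ∃[ τ′ ] (DelayedArgument τ′ τ × (ρᵢ ⊴ τ′)))
theorem4p4 ρ τ record { env = E ; coder = C ; decoder = D ; retract = DC=x } =
  let open Decoding ρ τ E
      ρ≡τ , all-coded = arguments-coded C D DC=x
  in ρ≡τ , λ ρᵢ i → let τ′ , (m , p) , ρᵢ⊴τ′ = Coded⇒⊴ i (all-coded i) in τ′ , (head ρ , m , p) , ρᵢ⊴τ′
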